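{- Let $\varphi_1$ and $\varphi_2$ be two $\mathbb{T}$-gains on a connected graph $G$ with $n$ vertices and $m$ edges. Let $T$ be a normal spanning tree of $G$ such that $\varphi_1(\overrightarrow{C_j(T)})=\varphi_2(\overrightarrow{C_j(T)})$ for all $j=1,\dots,m-n+1$. Then $A(\Phi_1)$ and $A(\Phi_2)$ have the same spectrum, i.e. $\Phi_1=(G,\varphi_1)$ and $\Phi_2=(G,\varphi_2)$ are $\mathbb{T}$-cospectral.
   Context: Graphs are finite, simple and undirected, $V(G)=\{v_1,\dots,v_n\}$. $\mathbb{T}=\{z\in\mathbb{C}:|z|=1\}$. A $\mathbb{T}$-gain on $G$ is a map $\varphi$ from oriented edges to $\mathbb{T}$ with $\varphi(\overrightarrow{e_{ts}})=\varphi(\overrightarrow{e_{st}})^{ -1}$; $\Phi=(G,\varphi)$ is a $\mathbb{T}$-gain graph, with adjacency matrix $A(\Phi)$ the $n\times n$ Hermitian matrix whose $(s,t)$ entry is $\varphi(\overrightarrow{e_{st}})$ if $v_s\sim v_t$ and $0$ otherwise. Two $\mathbb{T}$-gain graphs are $\mathbb{T}$-cospectral if their adjacency matrices have the same spectrum. The gain of a directed cycle is the product of gains of its oriented edges. A rooted spanning tree $T$ with root $v_r$ induces the tree order ($v_x\le v_y$ iff $v_x$ lies on the $T$-path from $v_r$ to $v_y$); $T$ is normal if adjacent vertices of $G$ are always comparable. The suitably oriented graph $\overrightarrow{G_T}$ orients each edge $e_{st}$ with $v_s\le v_t$ as $\overrightarrow{e_{st}}$ if $e_{st}\in E(T)$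 and as $\overrightarrow{e_{ts}}$ otherwise. Each of the $m-n+1$ non-tree edges creates a unique fundamental cycle with $T$, a directed cycle $\overrightarrow{C_j(T)}$ in $\overrightarrow{G_T}$. -}

module Defs where

open import Algebra.Bundles using (CommutativeRing)
import Algebra.Properties.Monoid.Sum as MonoidSum
import Algebra.Properties.Semiring.Exp as SemiringExp
import Algebra.Solver.Ring.NaturalCoefficients.Default as SemiringSolver
open import Data.Bool.Base using (Bool; T)
open import Data.Fin.Base using (Fin; zero; suc; toℕ; punchIn)
import Data.Fin.Properties as Fin
open import Data.List.Base using (List; []; _∷_; map; length)
open import Data.List.Membership.Propositional using (_∈_)
open import Data.List.Relation.Unary.All using (All)
open import Data.List.Relation.Unary.Unique.Propositional using (Unique)
open import Data.Nat.Base as ℕ using (ℕ; zero; suc)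
import Data.Nat.Properties as ℕ
open import Data.Product.Base using (Σ-syntax; ∃; _×_; _,_; proj₁; proj₂)
open import Data.Rational.Base as ℚ using (ℚ; 0ℚ; 1ℚ; ½)
import Data.Rational.Properties as ℚ
import Data.Rational.Solver as ℚSolver
open import Data.Sum.Base using (_⊎_)
open import Data.Vec.Functional using (Vector)
open import Function.Bundles using (_⇔_)
open import Level using (0ℓ)
open import Relation.Binary.Core using (Rel; _⇒_)
open import Relation.Binary.Construct.Closure.ReflexiveTransitive as Star
  using (Star; _◅_)
open import Relation.Binary.PropositionalEquality
  using (_≡_; refl; sym; trans; cong; subst)
open import Relation.Nullary.Decidable using (yes; no; T?)
open import Relation.Nullary.Negation using (¬_)

-- The reals are Cauchy sequences of rationals; equality of reals is the
-- relation _≈_ (difference tending to 0), not _≡_.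
module Real where

  IsCauchy : (ℕ → ℚ) → Set
  IsCauchy x = ∀ ε → 0ℚ ℚ.< ε → ∃ λ N → ∀ m k → N ℕ.≤ m → N ℕ.≤ k →
               ℚ.∣ x m ℚ.- x k ∣ ℚ.< ε

  record ℝ : Set where
    constructor mkℝ
    field
      seq    : ℕ → ℚ
      cauchy : IsCauchy seq

  open ℝ public

  infix 4 _≈_ _≤_

  _≈_ : Rel ℝ 0ℓ
  x ≈ y = ∀ ε → 0ℚ ℚ.< ε → ∃ λ N → ∀ m → N ℕ.≤ m →
          ℚ.∣ seq x m ℚ.- seq y m ∣ ℚ.< ε

  _≤_ : Rel ℝ 0ℓ
  x ≤ y = ∀ ε → 0ℚ ℚ.< ε → ∃ λ N → ∀ m → N ℕ.≤ m →
          seq x m ℚ.< seq y m ℚ.+ ε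

  private
    open ℚSolver.+-*-Solver

    abstract
      half-pos : ∀ {ε} → 0ℚ ℚ.< ε → 0ℚ ℚ.< ε ℚ.* ½
      half-pos {ε} 0<ε = subst (ℚ._< ε ℚ.* ½) (ℚ.*-zeroˡ ½) (ℚ.*-monoˡ-<-pos ½ 0<ε)

      half+half : ∀ ε → ε ℚ.* ½ ℚ.+ ε ℚ.* ½ ≡ ε
      half+half ε = trans (sym (ℚ.*-distribˡ-+ ε ½ ½)) (ℚ.*-identityʳ ε)

      tri : ∀ {ε} a b → ℚ.∣ a ∣ ℚ.< ε ℚ.* ½ → ℚ.∣ b ∣ ℚ.< ε ℚ.* ½ → ℚ.∣ a ℚ.+ b ∣ ℚ.< ε
      tri {ε} a b p q = ℚ.≤-<-trans (ℚ.∣p+q∣≤∣p∣+∣q∣ a b)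
        (subst (ℚ.∣ a ∣ ℚ.+ ℚ.∣ b ∣ ℚ.<_) (half+half ε) (ℚ.+-mono-< p q))

      abs-sub-comm : ∀ a b → ℚ.∣ a ℚ.- b ∣ ≡ ℚ.∣ b ℚ.- a ∣
      abs-sub-comm a b = trans (sym (ℚ.∣-p∣≡∣p∣ (a ℚ.- b)))
        (cong ℚ.∣_∣ (solve 2 (λ a b → :- (a :- b) := b :- a) refl a b))

      add-sub : ∀ a b c d → (a ℚ.- c) ℚ.+ (b ℚ.- d) ≡ (a ℚ.+ b) ℚ.- (c ℚ.+ d)
      add-sub = solve 4 (λ a b c d → (a :- c) :+ (b :- d) := (a :+ b) :- (c :+ d)) refl

      trans-sub : ∀ a b c → (a ℚ.- b) ℚ.+ (b ℚ.- c) ≡ a ℚ.- c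
      trans-sub = solve 3 (λ a b c → (a :- b) :+ (b :- c) := a :- c) refl

      neg-sub : ∀ a b → b ℚ.- a ≡ (ℚ.- a) ℚ.- (ℚ.- b)
      neg-sub = solve 2 (λ a b → b :- a := (:- a) :- (:- b)) refl

      mul-sub : ∀ a b c d → a ℚ.* (b ℚ.- d) ℚ.+ (a ℚ.- c) ℚ.* d ≡ a ℚ.* b ℚ.- c ℚ.* d
      mul-sub = solve 4 (λ a b c d → a :* (b :- d) :+ (a :- c) :* d := a :* b :- c :* d) refl

    abstract
      mul-lt : ∀ {B d} p q → 0ℚ ℚ.< B → ℚ.∣ p ∣ ℚ.< B → ℚ.∣ q ∣ ℚ.< d →
               ℚ.∣ p ℚ.* q ∣ ℚ.< B ℚ.* d
      mul-lt {B} {d} p q 0<B p<B q<d = ℚ.≤-<-trans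
        (subst (ℚ._≤ B ℚ.* ℚ.∣ q ∣) (sym (ℚ.∣p*q∣≡∣p∣*∣q∣ p q))
          (ℚ.*-monoʳ-≤-nonNeg ℚ.∣ q ∣ {{ℚ.nonNegative (ℚ.0≤∣p∣ q)}} (ℚ.<⇒≤ p<B)))
        (ℚ.*-monoʳ-<-pos B {{ℚ.positive 0<B}} q<d)

    abstract
      mul-sub-lt : ∀ {B C δ} a b c d → 0ℚ ℚ.< B → 0ℚ ℚ.< C →
        ℚ.∣ a ∣ ℚ.< B → ℚ.∣ d ∣ ℚ.< C →
        ℚ.∣ a ℚ.- c ∣ ℚ.< δ → ℚ.∣ b ℚ.- d ∣ ℚ.< δ →
        ℚ.∣ a ℚ.* b ℚ.- c ℚ.* d ∣ ℚ.< B ℚ.* δ ℚ.+ C ℚ.* δ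
      mul-sub-lt {B} {C} {δ} a b c d 0<B 0<C a<B d<C ac bd =
        subst (λ t → ℚ.∣ t ∣ ℚ.< B ℚ.* δ ℚ.+ C ℚ.* δ) (mul-sub a b c d)
          (ℚ.≤-<-trans (ℚ.∣p+q∣≤∣p∣+∣q∣ (a ℚ.* (b ℚ.- d)) ((a ℚ.- c) ℚ.* d))
            (ℚ.+-mono-< (mul-lt a (b ℚ.- d) 0<B a<B bd)
              (subst (λ t → ℚ.∣ t ∣ ℚ.< C ℚ.* δ) (ℚ.*-comm d (a ℚ.- c))
                (mul-lt d (a ℚ.- c) 0<C d<C ac))))

    abstract
      divide : ∀ K ε → 0ℚ ℚ.< K → 0ℚ ℚ.< ε → ∃ λ δ → 0ℚ ℚ.< δ × K ℚ.* δ ≡ ε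
      divide K ε 0<K 0<ε = 1/K ℚ.* ε
        , subst (ℚ._< 1/K ℚ.* ε) (ℚ.*-zeroʳ 1/K)
            (ℚ.*-monoʳ-<-pos 1/K {{ℚ.1/pos⇒pos K {{ℚ.positive 0<K}}}} 0<ε)
        , trans (sym (ℚ.*-assoc K 1/K ε))
            (trans (cong (ℚ._* ε) (ℚ.*-inverseʳ K {{nz}})) (ℚ.*-identityˡ ε))
        where
        nz : ℚ.NonZero K
        nz = ℚ.pos⇒nonZero K {{ℚ.positive 0<K}}
        1/K : ℚ
        1/K = ℚ.1/_ K {{nz}}

    abstract
      scale : ∀ B C ε → 0ℚ ℚ.< B → 0ℚ ℚ.< C → 0ℚ ℚ.< ε → ∃ λ δ → 0ℚ ℚ.< δ ×
        (∀ a b c d → ℚ.∣ a ∣ ℚ.< B → ℚ.∣ d ∣ ℚ.< C →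
          ℚ.∣ a ℚ.- c ∣ ℚ.< δ → ℚ.∣ b ℚ.- d ∣ ℚ.< δ →
          ℚ.∣ a ℚ.* b ℚ.- c ℚ.* d ∣ ℚ.< ε)
      scale B C ε 0<B 0<C 0<ε =
        let (δ , 0<δ , eq) = divide (B ℚ.+ C) ε (ℚ.+-mono-< 0<B 0<C) 0<ε
        in δ , 0<δ , λ a b c d a<B d<C ac bd →
          subst (ℚ.∣ a ℚ.* b ℚ.- c ℚ.* d ∣ ℚ.<_) (trans (sym (ℚ.*-distribʳ-+ δ B C)) eq)
            (mul-sub-lt a b c d 0<B 0<C a<B d<C ac bd)

    abstract
      eventually-bounded : ∀ x → ∃ λ B → 0ℚ ℚ.< B × ∃ λ N →
        ∀ m → N ℕ.≤ m → ℚ.∣ seq x m ∣ ℚ.< B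
      eventually-bounded x =
        let (N , c) = cauchy x 1ℚ (ℚ.positive⁻¹ 1ℚ)
        in 1ℚ ℚ.+ ℚ.∣ seq x N ∣
           , ℚ.+-mono-<-≤ (ℚ.positive⁻¹ 1ℚ) (ℚ.0≤∣p∣ (seq x N))
           , N
           , λ m N≤m → subst (λ t → ℚ.∣ t ∣ ℚ.< 1ℚ ℚ.+ ℚ.∣ seq x N ∣)
               (solve 2 (λ a b → (a :- b) :+ b := a) refl (seq x m) (seq x N))
               (ℚ.≤-<-trans (ℚ.∣p+q∣≤∣p∣+∣q∣ (seq x m ℚ.- seq x N) (seq x N))
                 (ℚ.+-mono-<-≤ (c m N N≤m ℕ.≤-refl) ℚ.≤-refl))

    abstract
      const-cauchy : ∀ q → IsCauchy (λ _ → q)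
      const-cauchy q ε 0<ε = 0 , λ _ _ _ _ →
        subst (λ t → ℚ.∣ t ∣ ℚ.< ε) (sym (ℚ.+-inverseʳ q)) 0<ε

      +-cauchy : ∀ x y → IsCauchy (λ m → seq x m ℚ.+ seq y m)
      +-cauchy x y ε 0<ε =
        let (N , p) = cauchy x (ε ℚ.* ½) (half-pos 0<ε)
            (M , q) = cauchy y (ε ℚ.* ½) (half-pos 0<ε)
        in N ℕ.⊔ M , λ m k hm hk →
        subst (λ t → ℚ.∣ t ∣ ℚ.< ε) (add-sub (seq x m) (seq y m) (seq x k) (seq y k))
          (tri _ _ (p m k (ℕ.m⊔n≤o⇒m≤o N M hm) (ℕ.m⊔n≤o⇒m≤o N M hk))
                   (q m k (ℕ.m⊔n≤o⇒n≤o N M hm) (ℕ.m⊔n≤o⇒n≤o N M hk)))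

      neg-cauchy : ∀ x → IsCauchy (λ m → ℚ.- seq x m)
      neg-cauchy x ε 0<ε = let (N , p) = cauchy x ε 0<ε in N , λ m k hm hk →
        subst (λ t → ℚ.∣ t ∣ ℚ.< ε) (neg-sub (seq x m) (seq x k)) (p k m hk hm)

    abstract
      *-cauchy : ∀ x y → IsCauchy (λ m → seq x m ℚ.* seq y m)
      *-cauchy x y ε 0<ε =
        let (B , 0<B , N₁ , bx) = eventually-bounded x
            (C , 0<C , N₂ , by) = eventually-bounded y
            (δ , 0<δ , est)     = scale B C ε 0<B 0<C 0<ε
            (N₃ , cx)           = cauchy x δ 0<δ
            (N₄ , cy)           = cauchy y δ 0<δ
        in (N₁ ℕ.⊔ N₂) ℕ.⊔ (N₃ ℕ.⊔ N₄) , λ m k hm hk →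
        est (seq x m) (seq y m) (seq x k) (seq y k)
          (bx m (ℕ.m⊔n≤o⇒m≤o N₁ N₂ (ℕ.m⊔n≤o⇒m≤o (N₁ ℕ.⊔ N₂) _ hm)))
          (by k (ℕ.m⊔n≤o⇒n≤o N₁ N₂ (ℕ.m⊔n≤o⇒m≤o (N₁ ℕ.⊔ N₂) _ hk)))
          (cx m k (ℕ.m⊔n≤o⇒m≤o N₃ N₄ (ℕ.m⊔n≤o⇒n≤o (N₁ ℕ.⊔ N₂) _ hm))
                  (ℕ.m⊔n≤o⇒m≤o N₃ N₄ (ℕ.m⊔n≤o⇒n≤o (N₁ ℕ.⊔ N₂) _ hk)))
          (cy m k (ℕ.m⊔n≤o⇒n≤o N₃ N₄ (ℕ.m⊔n≤o⇒n≤o (N₁ ℕ.⊔ N₂) _ hm))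
                  (ℕ.m⊔n≤o⇒n≤o N₃ N₄ (ℕ.m⊔n≤o⇒n≤o (N₁ ℕ.⊔ N₂) _ hk)))

  infixl 6 _+_
  infixl 7 _*_
  infix  8 -_

  0ℝ 1ℝ : ℝ
  0ℝ = mkℝ (λ _ → 0ℚ) (const-cauchy 0ℚ)
  1ℝ = mkℝ (λ _ → 1ℚ) (const-cauchy 1ℚ)

  _+_ _*_ : ℝ → ℝ → ℝ
  x + y = mkℝ (λ m → seq x m ℚ.+ seq y m) (+-cauchy x y)
  x * y = mkℝ (λ m → seq x m ℚ.* seq y m) (*-cauchy x y)

  -_ : ℝ → ℝ
  - x = mkℝ (λ m → ℚ.- seq x m) (neg-cauchy x)

  private
    abstract
      pointwise : ∀ x y → (∀ m → seq x m ≡ seq y m) → x ≈ y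
      pointwise x y eq ε 0<ε = 0 , λ m _ →
        subst (λ t → ℚ.∣ t ∣ ℚ.< ε)
          (sym (trans (cong (ℚ._- seq y m) (eq m)) (ℚ.+-inverseʳ (seq y m)))) 0<ε

      ≈-sym : ∀ {x y} → x ≈ y → y ≈ x
      ≈-sym {x} {y} p ε 0<ε = let (N , f) = p ε 0<ε in
        N , λ m hm → subst (ℚ._< ε) (abs-sub-comm (seq x m) (seq y m)) (f m hm)

      ≈-trans : ∀ {x y z} → x ≈ y → y ≈ z → x ≈ z
      ≈-trans {x} {y} {z} p q ε 0<ε =
        let (N , f) = p (ε ℚ.* ½) (half-pos 0<ε)
            (M , g) = q (ε ℚ.* ½) (half-pos 0<ε)
        in N ℕ.⊔ M , λ m hm →
        subst (λ t → ℚ.∣ t ∣ ℚ.< ε) (trans-sub (seq x m) (seq y m) (seq z m))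
          (tri _ _ (f m (ℕ.m⊔n≤o⇒m≤o N M hm)) (g m (ℕ.m⊔n≤o⇒n≤o N M hm)))

      +-cong : ∀ {x y u v} → x ≈ y → u ≈ v → x + u ≈ y + v
      +-cong {x} {y} {u} {v} p q ε 0<ε =
        let (N , f) = p (ε ℚ.* ½) (half-pos 0<ε)
            (M , g) = q (ε ℚ.* ½) (half-pos 0<ε)
        in N ℕ.⊔ M , λ m hm →
        subst (λ t → ℚ.∣ t ∣ ℚ.< ε) (add-sub (seq x m) (seq u m) (seq y m) (seq v m))
          (tri _ _ (f m (ℕ.m⊔n≤o⇒m≤o N M hm)) (g m (ℕ.m⊔n≤o⇒n≤o N M hm)))

      -‿cong : ∀ {x y} → x ≈ y → - x ≈ - y
      -‿cong {x} {y} p ε 0<ε = let (N , f) = ≈-sym {x} {y} p ε 0<ε in N , λ m hm →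
        subst (λ t → ℚ.∣ t ∣ ℚ.< ε) (neg-sub (seq x m) (seq y m)) (f m hm)

      *-cong : ∀ {x y u v} → x ≈ y → u ≈ v → x * u ≈ y * v
      *-cong {x} {y} {u} {v} p q ε 0<ε =
        let (B , 0<B , N₁ , bx) = eventually-bounded x
            (C , 0<C , N₂ , bv) = eventually-bounded v
            (δ , 0<δ , est)     = scale B C ε 0<B 0<C 0<ε
            (N₃ , f)            = p δ 0<δ
            (N₄ , g)            = q δ 0<δ
        in (N₁ ℕ.⊔ N₂) ℕ.⊔ (N₃ ℕ.⊔ N₄) , λ m hm →
        est (seq x m) (seq u m) (seq y m) (seq v m)
          (bx m (ℕ.m⊔n≤o⇒m≤o N₁ N₂ (ℕ.m⊔n≤o⇒m≤o (N₁ ℕ.⊔ N₂) _ hm)))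
          (bv m (ℕ.m⊔n≤o⇒n≤o N₁ N₂ (ℕ.m⊔n≤o⇒m≤o (N₁ ℕ.⊔ N₂) _ hm)))
          (f m (ℕ.m⊔n≤o⇒m≤o N₃ N₄ (ℕ.m⊔n≤o⇒n≤o (N₁ ℕ.⊔ N₂) _ hm)))
          (g m (ℕ.m⊔n≤o⇒n≤o N₃ N₄ (ℕ.m⊔n≤o⇒n≤o (N₁ ℕ.⊔ N₂) _ hm)))

  commutativeRing : CommutativeRing 0ℓ 0ℓ
  commutativeRing = record
    { Carrier = ℝ
    ; _≈_ = _≈_
    ; _+_ = _+_
    ; _*_ = _*_
    ; -_ = -_
    ; 0# = 0ℝ
    ; 1# = 1ℝ
    ; isCommutativeRing = record
      { isRing = record
        { +-isAbelianGroup = record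
          { isGroup = record
            { isMonoid = record
              { isSemigroup = record
                { isMagma = record
                  { isEquivalence = record
                    { refl  = λ {x} → pointwise x x λ _ → refl
                    ; sym   = λ {x y} → ≈-sym {x} {y}
                    ; trans = λ {x y z} → ≈-trans {x} {y} {z}
                    }
                  ; ∙-cong = λ {x y u v} → +-cong {x} {y} {u} {v}
                  }
                ; assoc = λ x y z → pointwise ((x + y) + z) (x + (y + z))
                    λ m → ℚ.+-assoc (seq x m) (seq y m) (seq z m)
                }
              ; identity = (λ x → pointwise (0ℝ + x) x λ m → ℚ.+-identityˡ (seq x m))
                         , (λ x → pointwise (x + 0ℝ) x λ m → ℚ.+-identityʳ (seq x m))
              }
            ; inverse = (λ x → pointwise (- x + x) 0ℝ λ m → ℚ.+-inverseˡ (seq x m))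
                      , (λ x → pointwise (x + - x) 0ℝ λ m → ℚ.+-inverseʳ (seq x m))
            ; ⁻¹-cong = λ {x y} → -‿cong {x} {y}
            }
          ; comm = λ x y → pointwise (x + y) (y + x) λ m → ℚ.+-comm (seq x m) (seq y m)
          }
        ; *-cong = λ {x y u v} → *-cong {x} {y} {u} {v}
        ; *-assoc = λ x y z → pointwise ((x * y) * z) (x * (y * z))
            λ m → ℚ.*-assoc (seq x m) (seq y m) (seq z m)
        ; *-identity = (λ x → pointwise (1ℝ * x) x λ m → ℚ.*-identityˡ (seq x m))
                     , (λ x → pointwise (x * 1ℝ) x λ m → ℚ.*-identityʳ (seq x m))
        ; distrib = (λ x y z → pointwise (x * (y + z)) (x * y + x * z)
                      λ m → ℚ.*-distribˡ-+ (seq x m) (seq y m) (seq z m))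
                  , (λ x y z → pointwise ((y + z) * x) (y * x + z * x)
                      λ m → ℚ.*-distribʳ-+ (seq x m) (seq y m) (seq z m))
        }
      ; *-comm = λ x y → pointwise (x * y) (y * x) λ m → ℚ.*-comm (seq x m) (seq y m)
      }
    }

open Real public using (ℝ)

-- R[i] for a commutative ring R; ℂ is the instance R = ℝ.
module Complexification (R : CommutativeRing 0ℓ 0ℓ) where

  open CommutativeRing R using (Carrier)
  private
    module R = CommutativeRing R
    open SemiringSolver R.commutativeSemiring using (solve; _:+_; _:*_; _:=_)

  infix 5 _+i_
  record Complex : Set where
    constructor _+i_
    field
      re im : Carrier

  open Complex public

  infix 4 _≈_
  infixl 6 _+_
  infixl 7 _*_
  infix  8 -_

  _≈_ : Rel Complex 0ℓ
  z ≈ w = re z R.≈ re w × im z R.≈ im w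

  0# 1# : Complex
  0# = R.0# +i R.0#
  1# = R.1# +i R.0#

  _+_ _*_ : Complex → Complex → Complex
  z + w = (re z R.+ re w) +i (im z R.+ im w)
  z * w = (re z R.* re w R.- im z R.* im w) +i (re z R.* im w R.+ im z R.* re w)

  -_ : Complex → Complex
  - z = (R.- re z) +i (R.- im z)

  commutativeRing : CommutativeRing 0ℓ 0ℓ
  commutativeRing = record
    { Carrier = Complex
    ; _≈_ = _≈_
    ; _+_ = _+_
    ; _*_ = _*_
    ; -_ = -_
    ; 0# = 0#
    ; 1# = 1#
    ; isCommutativeRing = record
      { isRing = record
        { +-isAbelianGroup = record
          { isGroup = record
            { isMonoid = record
              { isSemigroup = record
                { isMagma = record
                  { isEquivalence = record
                    { refl  = R.refl , R.refl
                    ; sym   = λ (p , q) → R.sym p , R.sym q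
                    ; trans = λ (p , q) (p′ , q′) → R.trans p p′ , R.trans q q′
                    }
                  ; ∙-cong = λ (p , q) (p′ , q′) → R.+-cong p p′ , R.+-cong q q′
                  }
                ; assoc = λ _ _ _ → R.+-assoc _ _ _ , R.+-assoc _ _ _
                }
              ; identity = (λ _ → R.+-identityˡ _ , R.+-identityˡ _)
                         , (λ _ → R.+-identityʳ _ , R.+-identityʳ _)
              }
            ; inverse = (λ _ → R.-‿inverseˡ _ , R.-‿inverseˡ _)
                      , (λ _ → R.-‿inverseʳ _ , R.-‿inverseʳ _)
            ; ⁻¹-cong = λ (p , q) → R.-‿cong p , R.-‿cong q
            }
          ; comm = λ _ _ → R.+-comm _ _ , R.+-comm _ _
          }
        ; *-cong = λ (p , q) (p′ , q′) →
            R.+-cong (R.*-cong p p′) (R.-‿cong (R.*-cong q q′))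
          , R.+-cong (R.*-cong p q′) (R.*-cong q p′)
        ; *-assoc = λ x y z → assoc-re (re x) (im x) (re y) (im y) (re z) (im z)
                            , assoc-im (re x) (im x) (re y) (im y) (re z) (im z)
        ; *-identity = (λ z → idˡ z) , (λ z → *-trans (*-comm z 1#) (idˡ z))
        ; distrib = distˡ
                  , (λ x y z → *-trans (*-comm (y + z) x)
                      (*-trans (distˡ x y z)
                        ( R.+-cong (proj₁ (*-comm x y)) (proj₁ (*-comm x z))
                        , R.+-cong (proj₂ (*-comm x y)) (proj₂ (*-comm x z)))))
        }
      ; *-comm = *-comm
      }
    }
    where
    *-trans : ∀ {x y z} → x ≈ y → y ≈ z → x ≈ z
    *-trans (p , q) (p′ , q′) = R.trans p p′ , R.trans q q′

    *-comm : ∀ x y → x * y ≈ y * x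
    *-comm x y = R.+-cong (R.*-comm _ _) (R.-‿cong (R.*-comm _ _))
               , R.trans (R.+-comm _ _) (R.+-cong (R.*-comm _ _) (R.*-comm _ _))

    x-0 : ∀ x y → x R.- R.0# R.* y R.≈ x
    x-0 x y = R.trans (R.+-congˡ (R.trans (R.-‿cong (R.zeroˡ y)) -0#≈0#)) (R.+-identityʳ x)
      where open import Algebra.Properties.Ring R.ring using (-0#≈0#)

    idˡ : ∀ z → 1# * z ≈ z
    idˡ z = R.trans (x-0 _ _) (R.*-identityˡ _)
          , R.trans (R.+-cong (R.*-identityˡ _) (R.zeroˡ _)) (R.+-identityʳ _)

    neg : ∀ x → R.- x R.≈ (R.- R.1#) R.* x
    neg x = R.sym (-1*x≈-x x)
      where open import Algebra.Properties.Ring R.ring using (-1*x≈-x)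

    -- The semiring solver knows no negation, so -1 is replaced by a variable k.
    dist-re : ∀ a b c d e f →
      a R.* (c R.+ e) R.- b R.* (d R.+ f)
      R.≈ (a R.* c R.- b R.* d) R.+ (a R.* e R.- b R.* f)
    dist-re a b c d e f =
      R.trans (R.+-congˡ (neg _))
        (R.trans (general a b c d e f (R.- R.1#))
          (R.sym (R.+-cong (R.+-congˡ (neg _)) (R.+-congˡ (neg _)))))
      where
      general : ∀ a b c d e f k →
        a R.* (c R.+ e) R.+ k R.* (b R.* (d R.+ f))
        R.≈ (a R.* c R.+ k R.* (b R.* d)) R.+ (a R.* e R.+ k R.* (b R.* f))
      general = solve 7 (λ a b c d e f k →
        (a :* (c :+ e) :+ k :* (b :* (d :+ f)))
        := ((a :* c :+ k :* (b :* d)) :+ (a :* e :+ k :* (b :* f)))) R.refl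

    dist-im : ∀ a b c d e f →
      a R.* (d R.+ f) R.+ b R.* (c R.+ e)
      R.≈ (a R.* d R.+ b R.* c) R.+ (a R.* f R.+ b R.* e)
    dist-im = solve 6 (λ a b c d e f →
      (a :* (d :+ f) :+ b :* (c :+ e))
      := ((a :* d :+ b :* c) :+ (a :* f :+ b :* e))) R.refl

    distˡ : ∀ x y z → x * (y + z) ≈ x * y + x * z
    distˡ x y z = dist-re (re x) (im x) (re y) (im y) (re z) (im z)
                , dist-im (re x) (im x) (re y) (im y) (re z) (im z)

    assoc-re : ∀ a b c d e f →
      (a R.* c R.- b R.* d) R.* e R.- (a R.* d R.+ b R.* c) R.* f
      R.≈ a R.* (c R.* e R.- d R.* f) R.- b R.* (c R.* f R.+ d R.* e)
    assoc-re a b c d e f =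
      R.trans (R.+-cong (R.*-congʳ (R.+-congˡ (neg _))) (neg _))
        (R.trans (general a b c d e f (R.- R.1#))
          (R.sym (R.+-cong (R.*-congˡ (R.+-congˡ (neg _))) (neg _))))
      where
      general : ∀ a b c d e f k →
        (a R.* c R.+ k R.* (b R.* d)) R.* e R.+ k R.* ((a R.* d R.+ b R.* c) R.* f)
        R.≈ a R.* (c R.* e R.+ k R.* (d R.* f)) R.+ k R.* (b R.* (c R.* f R.+ d R.* e))
      general = solve 7 (λ a b c d e f k →
        ((a :* c :+ k :* (b :* d)) :* e :+ k :* ((a :* d :+ b :* c) :* f))
        := (a :* (c :* e :+ k :* (d :* f)) :+ k :* (b :* (c :* f :+ d :* e)))) R.refl

    assoc-im : ∀ a b c d e f →
      (a R.* c R.- b R.* d) R.* f R.+ (a R.* d R.+ b R.* c) R.* e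
      R.≈ a R.* (c R.* f R.+ d R.* e) R.+ b R.* (c R.* e R.- d R.* f)
    assoc-im a b c d e f =
      R.trans (R.+-congʳ (R.*-congʳ (R.+-congˡ (neg _))))
        (R.trans (general a b c d e f (R.- R.1#))
          (R.sym (R.+-congˡ (R.*-congˡ (R.+-congˡ (neg _))))))
      where
      general : ∀ a b c d e f k →
        (a R.* c R.+ k R.* (b R.* d)) R.* f R.+ (a R.* d R.+ b R.* c) R.* e
        R.≈ a R.* (c R.* f R.+ d R.* e) R.+ b R.* (c R.* e R.+ k R.* (d R.* f))
      general = solve 7 (λ a b c d e f k →
        ((a :* c :+ k :* (b :* d)) :* f :+ (a :* d :+ b :* c) :* e)
        := (a :* (c :* f :+ d :* e) :+ b :* (c :* e :+ k :* (d :* f)))) R.refl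

module Complex = Complexification Real.commutativeRing

ℂ : Set
ℂ = Complex.Complex

ℂ-commutativeRing : CommutativeRing 0ℓ 0ℓ
ℂ-commutativeRing = Complex.commutativeRing

-- r is the modulus |z|, that is, the nonnegative square root of
-- (re z)² + (im z)².
IsModulus : ℂ → ℝ → Set
IsModulus z r = Real.0ℝ Real.≤ r ×
  (r Real.* r) Real.≈ (re z Real.* re z Real.+ im z Real.* im z)
  where open Complex using (re; im)

𝕋 : Set
𝕋 = Σ[ z ∈ ℂ ] IsModulus z Real.1ℝ

module Matrices (R : CommutativeRing 0ℓ 0ℓ) where

  open CommutativeRing R hiding (zero)
  open SemiringExp semiring using (_^_)
  open MonoidSum +-monoid using (sum)
  open MonoidSum *-monoid using () renaming (sum to product)

  Matrix : ℕ → Set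
  Matrix n = Fin n → Fin n → Carrier

  -- Laplace expansion along the first row.
  det : ∀ {n} → Matrix n → Carrier
  det {zero}  A = 1#
  det {suc n} A = sum λ j →
    (- 1#) ^ toℕ j * A zero j * det (λ s t → A (suc s) (punchIn j t))

  identity : ∀ {n} → Matrix n
  identity s t with s Fin.≟ t
  ... | yes _ = 1#
  ... | no  _ = 0#

  -- The characteristic polynomial det (z I - A), as a polynomial function.
  charPoly : ∀ {n} → Matrix n → Carrier → Carrier
  charPoly A z = det λ s t → z * identity s t - A s t

  -- λs lists the eigenvalues of A with multiplicity: the characteristic
  -- polynomial of A is ∏ᵢ (z - λᵢ).  Over the infinite field ℂ, equality of
  -- polynomial functions is equality of polynomials.
  IsSpectrum : ∀ {n} → Matrix n → Vector Carrier n → Set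
  IsSpectrum A λs = ∀ z → charPoly A z ≈ product λ i → z - λs i

  -- The order of the entries of λs is immaterial in IsSpectrum, so this
  -- compares spectra as multisets.
  SameSpectrum : ∀ {n} → Matrix n → Matrix n → Set
  SameSpectrum {n} A B = ∀ (λs : Vector Carrier n) → IsSpectrum A λs ⇔ IsSpectrum B λs

open Matrices ℂ-commutativeRing public

module _ {n : ℕ} {R : Rel (Fin n) 0ℓ} where

  arcs : ∀ {u v} → Star R u v → List (Fin n × Fin n)
  arcs Star.ε                      = []
  arcs (_◅_ {i = u} {j = v} _ w) = (u , v) ∷ arcs w

  vertices : ∀ {u v} → Star R u v → List (Fin n)
  vertices {u} Star.ε  = u ∷ []
  vertices {u} (_ ◅ w) = u ∷ vertices w

module _ {n : ℕ} (R : Rel (Fin n) 0ℓ) where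

  record Path (u v : Fin n) : Set where
    field
      walk     : Star R u v
      distinct : Unique (vertices walk)

  -- A directed cycle, presented from one of its vertices: a closed walk
  -- through at least three vertices, none visited twice.
  record Cycle : Set where
    field
      base     : Fin n
      walk     : Star R base base
      distinct : Unique (map proj₁ (arcs walk))
      long     : 3 ℕ.≤ length (arcs walk)

-- Finite simple graphs on Fin n.  Adjacency is Boolean so that s ∼ t is
-- decidable and has at most one proof: a function on proofs of s ∼ t is a
-- function on oriented edges.
record Graph (n : ℕ) : Set where
  field
    adj    : Fin n → Fin n → Bool
    symm   : ∀ {s t} → T (adj s t) → T (adj t s)
    irrefl : ∀ {s} → ¬ T (adj s s)

  _∼_ : Rel (Fin n) 0ℓ
  s ∼ t = T (adj s t)

  Connected : Set
  Connected = ∀ s t → Star _∼_ s t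

  Acyclic : Set
  Acyclic = ¬ Cycle _∼_

-- A spanning tree of G has the same vertex set Fin n as G.
record RootedSpanningTree {n} (G : Graph n) : Set where
  open Graph G using (_∼_)
  field
    tree      : Graph n
    root      : Fin n
    subgraph  : Graph._∼_ tree ⇒ _∼_
    connected : Graph.Connected tree
    acyclic   : Graph.Acyclic tree

  _∼ᵀ_ : Rel (Fin n) 0ℓ
  _∼ᵀ_ = Graph._∼_ tree

  -- x lies on the (unique) path in the tree from the root to y.
  _≤ᵀ_ : Rel (Fin n) 0ℓ
  x ≤ᵀ y = Σ[ P ∈ Path _∼ᵀ_ root y ] x ∈ vertices (Path.walk P)

  Normal : Set
  Normal = ∀ s t → s ∼ t → s ≤ᵀ t ⊎ t ≤ᵀ s

  -- The arcs of the suitably oriented graph.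
  data _⟶_ : Rel (Fin n) 0ℓ where
    tree-arc : ∀ {s t} → s ≤ᵀ t → s ∼ᵀ t → s ⟶ t
    back-arc : ∀ {s t} → s ≤ᵀ t → s ∼ t → ¬ (s ∼ᵀ t) → t ⟶ s

  ⟶⇒∼ : _⟶_ ⇒ _∼_
  ⟶⇒∼ (tree-arc _ e)   = subgraph e
  ⟶⇒∼ (back-arc _ e _) = Graph.symm G e

  -- C is the fundamental cycle created by the non-tree edge {s , t},
  -- directed as in the suitably oriented graph: a cycle all of whose edges
  -- other than {s , t} are in the tree.
  IsFundamentalCycle : Fin n → Fin n → Cycle _⟶_ → Set
  IsFundamentalCycle s t C = s ∼ t × ¬ (s ∼ᵀ t) ×
    All (λ (x , y) → x ∼ᵀ y ⊎ (x , y) ≡ (s , t) ⊎ (x , y) ≡ (t , s))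
        (arcs (Cycle.walk C))

-- The second field says that the two orientations of an edge have mutually
-- inverse gains.
record Gain {n} (G : Graph n) : Set where
  open Graph G
  open CommutativeRing ℂ-commutativeRing
  field
    gain         : ∀ {s t} → s ∼ t → 𝕋
    gain-inverse : ∀ {s t} (e : s ∼ t) → proj₁ (gain (symm e)) * proj₁ (gain e) ≈ 1#

  adjacencyMatrix : Matrix n
  adjacencyMatrix s t with T? (adj s t)
  ... | yes e = proj₁ (gain e)
  ... | no  _ = 0#

  walkGain : ∀ {u v} → Star _∼_ u v → ℂ
  walkGain Star.ε  = 1#
  walkGain (e ◅ w) = proj₁ (gain e) * walkGain w

  cycleGain : {R : Rel (Fin n) 0ℓ} → R ⇒ _∼_ → Cycle R → ℂ
  cycleGain f C = walkGain (Star.map f (Cycle.walk C))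

𝕋-Cospectral : ∀ {n} {G H : Graph n} → Gain G → Gain H → Set
𝕋-Cospectral φ₁ φ₂ =
  SameSpectrum (Gain.adjacencyMatrix φ₁) (Gain.adjacencyMatrix φ₂)

{-# OPTIONS --safe #-}

-- For each gain φ, let p v and q v be the gains of tree walks from the root to
-- v and from v to the root.  A closed tree walk has trivial gain: cut it at
-- repeated vertices until only walks e e⁻¹ remain.  So p v and q v are mutually
-- inverse, and the rescaled gain p s φ(st) q t of an edge is 1
-- if the edge lies in the tree and otherwise the gain of its fundamental cycle
-- or the inverse of that gain.  Hence the rescaled adjacency matrices of φ₁ and
-- φ₂ coincide, while diagonal rescaling by p and q preserves the
-- characteristic polynomial.
module Submission where

open import Defs hiding (Matrix; det; identity; charPoly; IsSpectrum; SameSpectrum)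
open import Data.Nat.Base using (ℕ)
open import Data.Fin.Base using (Fin)
open import Algebra.Bundles using (CommutativeRing)

open import Algebra.Bundles using (CommutativeMonoid)
import Algebra.Properties.CommutativeMonoid.Sum as CommutativeMonoidSum
import Algebra.Properties.Ring as RingProperties
import Algebra.Properties.Semiring.Exp as SemiringExp
import Algebra.Properties.Semiring.Sum as SemiringSum
import Algebra.Solver.CommutativeMonoid as CommutativeMonoidSolver
open import Data.Bool.Properties using (T-irrelevant)
open import Data.Fin.Base using (zero; suc; toℕ; punchIn)
import Data.Fin.Properties as Fin
open import Data.List.Base using (List; []; _∷_; _++_; [_]; map; length)
import Data.List.Membership.DecPropositional as DecMembership
open import Data.List.Membership.Propositional using (_∈_)
open import Data.List.Membership.Propositional.Properties using (∈-++⁺ˡ; ∈-++⁺ʳ)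
open import Data.List.Properties using (++-assoc; map-++; length-++)
open import Data.List.Relation.Unary.All as All using (All; []; _∷_)
import Data.List.Relation.Unary.All.Properties as All
open import Data.List.Relation.Unary.AllPairs using ([]; _∷_)
open import Data.List.Relation.Unary.Any using (here; there)
open import Data.List.Relation.Unary.Unique.Propositional using (Unique)
open import Data.Nat.Base as ℕ using (zero; suc; z≤n; s≤s)
import Data.Nat.Properties as ℕ
open import Data.Product.Base using (Σ-syntax; ∃; _×_; _,_; proj₁; proj₂)
open import Data.Sum.Base using (_⊎_; inj₁; inj₂)
open import Data.Vec.Functional using (Vector)
open import Function.Bundles using (mk⇔)
open import Level using (0ℓ)
open import Relation.Binary.Core using (Rel; _⇒_)
open import Relation.Binary.Construct.Closure.ReflexiveTransitive as Star
  using (Star; _◅_; _◅◅_)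
open import Relation.Binary.Construct.Closure.ReflexiveTransitive.Properties using (◅◅-assoc)
open import Relation.Binary.PropositionalEquality as ≡ using (_≡_)
import Relation.Binary.Reasoning.Setoid as SetoidReasoning
open import Relation.Nullary.Decidable using (yes; no; T?)
open import Relation.Nullary.Negation using (¬_; contradiction)

-- Walks: concatenation, cutting and repeated vertices.

Unique-++ˡ : ∀ {A : Set} (xs : List A) {ys} → Unique (xs ++ ys) → Unique xs
Unique-++ˡ []       _          = []
Unique-++ˡ (x ∷ xs) (x∉ ∷ uniq) = All.++⁻ˡ xs x∉ ∷ Unique-++ˡ xs uniq

Unique-++ʳ : ∀ {A : Set} (xs : List A) {ys} → Unique (xs ++ ys) → Unique ys
Unique-++ʳ []       uniq       = uniq
Unique-++ʳ (x ∷ xs) (_ ∷ uniq) = Unique-++ʳ xs uniq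

module _ {n : ℕ} {R : Rel (Fin n) 0ℓ} where

  sources : ∀ {u v} → Star R u v → List (Fin n)
  sources w = map proj₁ (arcs w)

  arcs-◅◅ : ∀ {u v x} (a : Star R u v) (b : Star R v x) → arcs (a ◅◅ b) ≡ arcs a ++ arcs b
  arcs-◅◅ Star.ε  b = ≡.refl
  arcs-◅◅ (e ◅ a) b = ≡.cong (_ ∷_) (arcs-◅◅ a b)

  length-arcs-◅◅ : ∀ {u v x} (a : Star R u v) (b : Star R v x) →
                   length (arcs (a ◅◅ b)) ≡ length (arcs a) ℕ.+ length (arcs b)
  length-arcs-◅◅ a b = ≡.trans (≡.cong length (arcs-◅◅ a b)) (length-++ (arcs a))

  vertices-◅◅ : ∀ {u v x} (a : Star R u v) (b : Star R v x) →
                vertices (a ◅◅ b) ≡ sources a ++ vertices b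
  vertices-◅◅ Star.ε  b = ≡.refl
  vertices-◅◅ (e ◅ a) b = ≡.cong (_ ∷_) (vertices-◅◅ a b)

  vertices-sources : ∀ {u v} (w : Star R u v) → vertices w ≡ sources w ++ [ v ]
  vertices-sources Star.ε  = ≡.refl
  vertices-sources (e ◅ w) = ≡.cong (_ ∷_) (vertices-sources w)

  -- The last vertex `v` of `a` is the first vertex of `b`; the case split on `b` exposes it at the
  -- head of `vertices b`.
  Unique-vertices-prefix : ∀ {u v x} (a : Star R u v) (b : Star R v x) →
                           Unique (vertices (a ◅◅ b)) → Unique (vertices a)
  Unique-vertices-prefix a Star.ε uniq
    rewrite vertices-sources a | vertices-◅◅ a Star.ε = uniq
  Unique-vertices-prefix {v = v} a (e ◅ b) uniq
    rewrite vertices-sources a | vertices-◅◅ a (e ◅ b) =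
      Unique-++ˡ (sources a ++ [ v ])
        (≡.subst Unique (≡.sym (++-assoc (sources a) [ v ] (vertices b))) uniq)

  Unique-vertices-suffix : ∀ {u v x} (a : Star R u v) (b : Star R v x) →
                           Unique (vertices (a ◅◅ b)) → Unique (vertices b)
  Unique-vertices-suffix a b uniq rewrite vertices-◅◅ a b = Unique-++ʳ (sources a) uniq

  split-at : ∀ {u v x} (w : Star R u v) → x ∈ vertices w →
             Σ[ a ∈ Star R u x ] Σ[ b ∈ Star R x v ] a ◅◅ b ≡ w
  split-at Star.ε  (here ≡.refl) = Star.ε , Star.ε , ≡.refl
  split-at (e ◅ w) (here ≡.refl) = Star.ε , e ◅ w , ≡.refl
  split-at (e ◅ w) (there x∈w)   =
    let (a , b , eq) = split-at w x∈w in e ◅ a , b , ≡.cong (e ◅_) eq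

  -- A source, unlike an arbitrary vertex, has an arc leaving it, so the part of the walk from `x`
  -- onwards is nonempty.
  split-at-source : ∀ {u v x} (w : Star R u v) → x ∈ sources w →
    Σ[ a ∈ Star R u x ] ∃ λ y → Σ[ e ∈ R x y ] Σ[ b ∈ Star R y v ] a ◅◅ (e ◅ b) ≡ w
  split-at-source (e ◅ w) (here ≡.refl) = Star.ε , _ , e , w , ≡.refl
  split-at-source (e ◅ w) (there x∈w)   =
    let (a , y , e′ , b , eq) = split-at-source w x∈w in e ◅ a , y , e′ , b , ≡.cong (e ◅_) eq

  -- Cutting w at x leaves arc ◅ back and pre ◅◅ (arc′ ◅ post), which are both
  -- nonempty and hence both shorter than w.
  record Repetition {u v} (w : Star R u v) : Set where
    constructor repetition
    field
      {x y z} : Fin n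
      pre     : Star R u x
      arc     : R x y
      back    : Star R y x
      arc′    : R x z
      post    : Star R z v
      split   : pre ◅◅ ((arc ◅ back) ◅◅ (arc′ ◅ post)) ≡ w

  -- Sources are tested rather than vertices, since a closed walk always meets its base again at the
  -- end. If the first source recurs, the walk up to its recurrence is the loop to be cut out.
  unique-or-repetition : ∀ {u v} (w : Star R u v) → Unique (sources w) ⊎ Repetition w
  unique-or-repetition Star.ε = inj₁ []
  unique-or-repetition {u} (e ◅ w) with u ∈? sources w
    where open DecMembership (Fin._≟_ {n}) using (_∈?_)
  ... | yes u∈w =
    let (a , _ , e′ , b , eq) = split-at-source w u∈w
    in inj₂ (repetition Star.ε e a e′ b (≡.cong (e ◅_) eq))
  ... | no u∉w with unique-or-repetition w
  ...   | inj₁ uniq = inj₁ (All.¬Any⇒All¬ _ u∉w ∷ uniq)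
  ...   | inj₂ (repetition pre arc back arc′ post eq) =
    inj₂ (repetition (e ◅ pre) arc back arc′ post (≡.cong (e ◅_) eq))

-- Products of edge weights along walks, and closed walks in an acyclic graph.

module WalkProduct (M : CommutativeMonoid 0ℓ 0ℓ) where

  open CommutativeMonoid M
  open CommutativeMonoidSolver M using (solve; _⊕_; _⊜_)
  open SetoidReasoning setoid

  inverse-unique : ∀ {x y z} → y ∙ x ≈ ε → z ∙ x ≈ ε → y ≈ z
  inverse-unique {x} {y} {z} yx zx = begin
    y            ≈⟨ identityˡ y ⟨
    ε ∙ y        ≈⟨ ∙-congʳ zx ⟨
    (z ∙ x) ∙ y  ≈⟨ solve 3 (λ x y z → (z ⊕ x) ⊕ y ⊜ z ⊕ (y ⊕ x)) refl x y z ⟩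
    z ∙ (y ∙ x)  ≈⟨ ∙-congˡ yx ⟩
    z ∙ ε        ≈⟨ identityʳ z ⟩
    z            ∎

  module _ {n} {R : Rel (Fin n) 0ℓ} (f : ∀ {s t} → R s t → Carrier) where

    walkProduct : ∀ {u v} → Star R u v → Carrier
    walkProduct Star.ε  = ε
    walkProduct (e ◅ w) = f e ∙ walkProduct w

    walkProduct-◅◅ : ∀ {u v x} (a : Star R u v) (b : Star R v x) →
                     walkProduct (a ◅◅ b) ≈ walkProduct a ∙ walkProduct b
    walkProduct-◅◅ Star.ε  b = sym (identityˡ _)
    walkProduct-◅◅ (e ◅ a) b = trans (∙-congˡ (walkProduct-◅◅ a b)) (sym (assoc _ _ _))

  module _ {n} (H : Graph n) (acyclic : Graph.Acyclic H)
           (f : ∀ {s t} → Graph._∼_ H s t → Carrier)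
           (f-inverse : ∀ {s t} (e : Graph._∼_ H s t) → f (Graph.symm H e) ∙ f e ≈ ε) where

    open Graph H using (_∼_; symm; irrefl)

    private
      -- Induction on a length bound: the loop and the shortened walk obtained by cutting are
      -- shorter than `w` but are not subterms of it.
      bounded-closed-walk : ∀ k {u} (w : Star _∼_ u u) → length (arcs w) ℕ.< k →
                            walkProduct f w ≈ ε
      -- Acyclicity excludes three or more arcs and irreflexivity excludes one, so only the empty
      -- walk and an edge traversed back and forth remain.
      distinct-closed-walk : ∀ {u} (w : Star _∼_ u u) → Unique (sources w) →
                             walkProduct f w ≈ ε

      distinct-closed-walk Star.ε           uniq = refl
      distinct-closed-walk (e ◅ Star.ε)     uniq = contradiction e irrefl
      -- Adjacency has at most one proof, so the returning arc `e′` is the reverse of `e`.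
      distinct-closed-walk (e ◅ e′ ◅ Star.ε) uniq
        rewrite T-irrelevant e′ (symm e) = begin
          f e ∙ (f (symm e) ∙ ε)  ≈⟨ ∙-congˡ (identityʳ _) ⟩
          f e ∙ f (symm e)        ≈⟨ comm _ _ ⟩
          f (symm e) ∙ f e        ≈⟨ f-inverse e ⟩
          ε                       ∎
      distinct-closed-walk w@(_ ◅ _ ◅ _ ◅ _) uniq = contradiction
        (record { walk = w ; distinct = uniq ; long = s≤s (s≤s (s≤s z≤n)) }) acyclic

      bounded-closed-walk zero    w ()
      bounded-closed-walk (suc k) w (s≤s len) with unique-or-repetition w
      ... | inj₁ uniq = distinct-closed-walk w uniq
      ... | inj₂ (repetition pre e back e′ post ≡.refl) = begin
        walkProduct f (pre ◅◅ (loop ◅◅ rest))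
          ≈⟨ walkProduct-◅◅ f pre (loop ◅◅ rest) ⟩
        walkProduct f pre ∙ walkProduct f (loop ◅◅ rest)
          ≈⟨ ∙-congˡ (walkProduct-◅◅ f loop rest) ⟩
        walkProduct f pre ∙ (walkProduct f loop ∙ walkProduct f rest)
          ≈⟨ ∙-congˡ (∙-congʳ (bounded-closed-walk k loop loop<k)) ⟩
        walkProduct f pre ∙ (ε ∙ walkProduct f rest)
          ≈⟨ ∙-congˡ (identityˡ _) ⟩
        walkProduct f pre ∙ walkProduct f rest
          ≈⟨ walkProduct-◅◅ f pre rest ⟨
        walkProduct f (pre ◅◅ rest)
          ≈⟨ bounded-closed-walk k (pre ◅◅ rest) short<k ⟩
        ε ∎
        where
        loop = e ◅ back
        rest = e′ ◅ post
        a = length (arcs pre)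
        b = length (arcs loop)
        c = length (arcs rest)
        total≤k : a ℕ.+ (b ℕ.+ c) ℕ.≤ k
        total≤k = ≡.subst (ℕ._≤ k)
          (≡.trans (length-arcs-◅◅ pre (loop ◅◅ rest)) (≡.cong (a ℕ.+_) (length-arcs-◅◅ loop rest)))
          len
        -- The bound drops for `loop` because `rest` is nonempty, and below for `pre ◅◅ rest`
        -- because `loop` is nonempty.
        loop<k : b ℕ.< k
        loop<k = ℕ.<-≤-trans (ℕ.m<m+n b (s≤s z≤n)) (ℕ.≤-trans (ℕ.m≤n+m (b ℕ.+ c) a) total≤k)
        short<k : length (arcs (pre ◅◅ rest)) ℕ.< k
        short<k = ≡.subst (ℕ._< k) (≡.sym (length-arcs-◅◅ pre rest))
          (ℕ.<-≤-trans (ℕ.+-monoʳ-< a (ℕ.m<n+m c (s≤s z≤n))) total≤k)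

    closed-walk : ∀ {u} (w : Star _∼_ u u) → walkProduct f w ≈ ε
    closed-walk w = bounded-closed-walk _ w ℕ.≤-refl

-- Fundamental cycles in the suitably oriented graph.

module _ {n} {G : Graph n} (𝒯 : RootedSpanningTree G) where

  open Graph G using (_∼_; symm; irrefl)
  open RootedSpanningTree 𝒯

  -- Prefixes of a path from the root are such paths, so the arcs of the path
  -- are oriented away from the root.
  orient : ∀ {x t} (p : Star _∼ᵀ_ root x) (w : Star _∼ᵀ_ x t) →
           Unique (vertices (p ◅◅ w)) → Star _⟶_ x t
  orient p Star.ε  uniq = Star.ε
  orient {x} p (_◅_ {j = y} e w) uniq = tree-arc x≤y e ◅ orient (p ◅◅ (e ◅ Star.ε)) w uniq′
    where
    uniq′ : Unique (vertices ((p ◅◅ (e ◅ Star.ε)) ◅◅ w))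
    uniq′ = ≡.subst (λ q → Unique (vertices q)) (≡.sym (◅◅-assoc p (e ◅ Star.ε) w)) uniq
    x≤y : x ≤ᵀ y
    x≤y = record { walk = p ◅◅ (e ◅ Star.ε)
                 ; distinct = Unique-vertices-prefix (p ◅◅ (e ◅ Star.ε)) w uniq′ }
        , ≡.subst (x ∈_) (≡.sym (vertices-◅◅ p (e ◅ Star.ε))) (∈-++⁺ʳ (sources p) (here ≡.refl))

  arcs-orient : ∀ {x t} (p : Star _∼ᵀ_ root x) (w : Star _∼ᵀ_ x t)
                (uniq : Unique (vertices (p ◅◅ w))) → arcs (orient p w uniq) ≡ arcs w
  arcs-orient p Star.ε  uniq = ≡.refl
  arcs-orient p (e ◅ w) uniq = ≡.cong (_ ∷_) (arcs-orient (p ◅◅ (e ◅ Star.ε)) w _)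

  arcs-related : ∀ {x t} (w : Star _∼ᵀ_ x t) → All (λ (a , b) → a ∼ᵀ b) (arcs w)
  arcs-related Star.ε  = []
  arcs-related (e ◅ w) = e ∷ arcs-related w

  -- The data `p`, `w` are a path from the root to `t` cut at `s`, as supplied by `s ≤ᵀ t`. The
  -- cycle follows `w` down to `t` and returns by the non-tree edge.
  module FundamentalCycle {s t} (p : Star _∼ᵀ_ root s) (w : Star _∼ᵀ_ s t)
    (uniq : Unique (vertices (p ◅◅ w))) (e : s ∼ t) (e∉T : ¬ (s ∼ᵀ t)) where

    s≤t : s ≤ᵀ t
    s≤t = record { walk = p ◅◅ w ; distinct = uniq }
        , ≡.subst (s ∈_) (≡.sym (vertices-◅◅ p w)) (∈-++⁺ʳ (sources p) (start w))
      where
      start : ∀ {u v} (a : Star _∼ᵀ_ u v) → u ∈ vertices a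
      start Star.ε  = here ≡.refl
      start (_ ◅ _) = here ≡.refl

    closingArc : t ⟶ s
    closingArc = back-arc s≤t e e∉T

    cycleWalk : Star _⟶_ s s
    cycleWalk = orient p w uniq ◅◅ (closingArc ◅ Star.ε)

    arcs-cycleWalk : arcs cycleWalk ≡ arcs w ++ [ t , s ]
    arcs-cycleWalk = ≡.trans (arcs-◅◅ (orient p w uniq) (closingArc ◅ Star.ε))
                             (≡.cong (_++ [ t , s ]) (arcs-orient p w uniq))

    -- The closing arc contributes its source `t`, the one vertex of `w` that is not a source of
    -- `w`. Distinctness for the cycle thus reduces to that for the path.
    sources-cycleWalk : sources cycleWalk ≡ vertices w
    sources-cycleWalk = ≡.trans (≡.cong (map proj₁) arcs-cycleWalk)
      (≡.trans (map-++ proj₁ (arcs w) [ t , s ]) (≡.sym (vertices-sources w)))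

    -- A walk without arcs would make the edge a loop, and a single arc would put it in the tree.
    -- The endpoint `v` is a variable so that the walk can be matched on.
    2≤length : ∀ {v} (a : Star _∼ᵀ_ s v) → s ∼ v → ¬ (s ∼ᵀ v) → 2 ℕ.≤ length (arcs a)
    2≤length Star.ε           s∼v _    = contradiction s∼v irrefl
    2≤length (s∼ᵀv ◅ Star.ε)  _   s≁ᵀv = contradiction s∼ᵀv s≁ᵀv
    2≤length (_ ◅ _ ◅ _)      _   _    = s≤s (s≤s z≤n)

    cycle : Cycle _⟶_
    cycle = record
      { base     = s
      ; walk     = cycleWalk
      ; distinct = ≡.subst Unique (≡.sym sources-cycleWalk) (Unique-vertices-suffix p w uniq)
      ; long     = ≡.subst (3 ℕ.≤_)
          (≡.sym (≡.trans (≡.cong length arcs-cycleWalk) (length-++ (arcs w))))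
          (ℕ.+-monoˡ-≤ 1 (2≤length w e e∉T))
      }

    isFundamental : IsFundamentalCycle s t cycle
    isFundamental = e , e∉T , ≡.subst (All _) (≡.sym arcs-cycleWalk)
      (All.++⁺ (All.map inj₁ (arcs-related w)) (inj₂ (inj₂ ≡.refl) ∷ []))

-- Switching a gain by its tree walks.

module Switching (M : CommutativeMonoid 0ℓ 0ℓ) {n} {G : Graph n} (𝒯 : RootedSpanningTree G) where

  open Graph G using (_∼_; symm)
  open RootedSpanningTree 𝒯
  open CommutativeMonoid M
  open CommutativeMonoidSolver M using (solve; _⊕_; _⊜_)
  open SetoidReasoning setoid
  open WalkProduct M

  module Normalised (f : ∀ {s t} → s ∼ t → Carrier)
                    (f-inverse : ∀ {s t} (e : s ∼ t) → f (symm e) ∙ f e ≈ ε) where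

    private
      treeProduct : ∀ {u v} → Star _∼ᵀ_ u v → Carrier
      treeProduct = walkProduct (λ e → f (subgraph e))

      -- The reverse of an edge taken in the tree and the one taken in `G` are the same proof of
      -- adjacency.
      tree-inverse : ∀ {s t} (e : s ∼ᵀ t) →
                     f (subgraph (Graph.symm tree e)) ∙ f (subgraph e) ≈ ε
      tree-inverse e = trans
        (∙-congʳ (reflexive (≡.cong f (T-irrelevant _ (symm (subgraph e))))))
        (f-inverse (subgraph e))

      closed : ∀ {u} (w : Star _∼ᵀ_ u u) → treeProduct w ≈ ε
      closed = closed-walk tree acyclic (λ e → f (subgraph e)) tree-inverse

    -- A monoid has no inverse operation, so the inverse of `p v` is obtained from a return walk.
    -- That walk need not reverse the outgoing one.
    p q : Fin n → Carrier
    p v = treeProduct (connected root v)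
    q v = treeProduct (connected v root)

    p∙q : ∀ v → p v ∙ q v ≈ ε
    p∙q v = trans (sym (walkProduct-◅◅ _ (connected root v) (connected v root)))
                  (closed (connected root v ◅◅ connected v root))

    normalised : ∀ {s t} → s ∼ t → Carrier
    normalised {s} {t} e = p s ∙ f e ∙ q t

    normalised-symm : ∀ {s t} (e : s ∼ t) → normalised (symm e) ∙ normalised e ≈ ε
    normalised-symm {s} {t} e = begin
      (p t ∙ f (symm e) ∙ q s) ∙ (p s ∙ f e ∙ q t)
        ≈⟨ solve 6 (λ pt g qs ps h qt →
             ((pt ⊕ g) ⊕ qs) ⊕ ((ps ⊕ h) ⊕ qt) ⊜ (pt ⊕ qt) ⊕ ((ps ⊕ qs) ⊕ (g ⊕ h)))
             refl (p t) (f (symm e)) (q s) (p s) (f e) (q t) ⟩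
      (p t ∙ q t) ∙ ((p s ∙ q s) ∙ (f (symm e) ∙ f e))
        ≈⟨ ∙-cong (p∙q t) (∙-cong (p∙q s) (f-inverse e)) ⟩
      ε ∙ (ε ∙ ε)
        ≈⟨ trans (identityˡ _) (identityˡ _) ⟩
      ε ∎

    -- Up to order, `p t ∙ q s` is the product along a tree walk from `s` through the root to `t`.
    -- It and `treeProduct w` are both inverse to the product along the same tree walk `w⁻` from `t`
    -- back to `s`, hence equal.
    normalised-closing : ∀ {s t} (w : Star _∼ᵀ_ s t) (e : t ∼ s) →
                         normalised e ≈ treeProduct w ∙ f e
    normalised-closing {s} {t} w e = begin
      p t ∙ f e ∙ q s
        ≈⟨ solve 3 (λ pt g qs → (pt ⊕ g) ⊕ qs ⊜ (pt ⊕ qs) ⊕ g) refl (p t) (f e) (q s) ⟩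
      (p t ∙ q s) ∙ f e
        ≈⟨ ∙-congʳ (inverse-unique backwards forwards) ⟩
      treeProduct w ∙ f e ∎
      where
      w⁻ = connected t root ◅◅ connected root s
      w⁻-product : treeProduct w⁻ ≈ q t ∙ p s
      w⁻-product = walkProduct-◅◅ _ (connected t root) (connected root s)
      backwards : (p t ∙ q s) ∙ treeProduct w⁻ ≈ ε
      backwards = begin
        (p t ∙ q s) ∙ treeProduct w⁻  ≈⟨ ∙-congˡ w⁻-product ⟩
        (p t ∙ q s) ∙ (q t ∙ p s)
          ≈⟨ solve 4 (λ pt qs qt ps → (pt ⊕ qs) ⊕ (qt ⊕ ps) ⊜ (pt ⊕ qt) ⊕ (ps ⊕ qs))
               refl (p t) (q s) (q t) (p s) ⟩
        (p t ∙ q t) ∙ (p s ∙ q s)     ≈⟨ ∙-cong (p∙q t) (p∙q s) ⟩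
        ε ∙ ε                         ≈⟨ identityˡ ε ⟩
        ε                             ∎
      forwards : treeProduct w ∙ treeProduct w⁻ ≈ ε
      forwards = trans (sym (walkProduct-◅◅ _ w w⁻)) (closed (w ◅◅ w⁻))

    -- The closed walk completed by a tree edge may be taken to be that edge and its reverse.
    normalised-tree : ∀ {s t} (e : s ∼ t) → s ∼ᵀ t → normalised e ≈ ε
    normalised-tree e e∈T rewrite T-irrelevant e (subgraph e∈T) = begin
      normalised (subgraph e∈T)
        ≈⟨ normalised-closing (Graph.symm tree e∈T ◅ Star.ε) (subgraph e∈T) ⟩
      (f (subgraph (Graph.symm tree e∈T)) ∙ ε) ∙ f (subgraph e∈T)
        ≈⟨ ∙-congʳ (identityʳ _) ⟩
      f (subgraph (Graph.symm tree e∈T)) ∙ f (subgraph e∈T)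
        ≈⟨ tree-inverse e∈T ⟩
      ε ∎

    -- The cycle traverses the non-tree edge from `t` to `s`, which is why `symm e` appears rather
    -- than `e`.
    normalised-fundamental : ∀ {s t} (a : Star _∼ᵀ_ root s) (w : Star _∼ᵀ_ s t)
      (uniq : Unique (vertices (a ◅◅ w))) (e : s ∼ t) (e∉T : ¬ (s ∼ᵀ t)) →
      normalised (symm e) ≈
        walkProduct (λ r → f (⟶⇒∼ r)) (Cycle.walk (FundamentalCycle.cycle 𝒯 a w uniq e e∉T))
    normalised-fundamental a w uniq e e∉T = begin
      normalised (symm e)                ≈⟨ normalised-closing w (symm e) ⟩
      treeProduct w ∙ f (symm e)         ≈⟨ ∙-cong (oriented a w uniq) (identityʳ _) ⟨
      arcProduct (orient 𝒯 a w uniq) ∙ (f (symm e) ∙ ε)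
        ≈⟨ walkProduct-◅◅ (λ r → f (⟶⇒∼ r)) (orient 𝒯 a w uniq)
             (FundamentalCycle.closingArc 𝒯 a w uniq e e∉T ◅ Star.ε) ⟨
      arcProduct (FundamentalCycle.cycleWalk 𝒯 a w uniq e e∉T) ∎
      where
      arcProduct : ∀ {u v} → Star _⟶_ u v → Carrier
      arcProduct = walkProduct (λ r → f (⟶⇒∼ r))
      oriented : ∀ {x y} (b : Star _∼ᵀ_ root x) (c : Star _∼ᵀ_ x y) uniq →
                 arcProduct (orient 𝒯 b c uniq) ≈ treeProduct c
      oriented b Star.ε  uniq = refl
      oriented b (r ◅ c) uniq = ∙-congˡ (oriented (b ◅◅ (r ◅ Star.ε)) c _)

  module _ (normal : Normal)
    (f g : ∀ {s t} → s ∼ t → Carrier)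
    (f-inverse : ∀ {s t} (e : s ∼ t) → f (symm e) ∙ f e ≈ ε)
    (g-inverse : ∀ {s t} (e : s ∼ t) → g (symm e) ∙ g e ≈ ε)
    (same-cycle-product : ∀ s t (C : Cycle _⟶_) → IsFundamentalCycle s t C →
      walkProduct (λ r → f (⟶⇒∼ r)) (Cycle.walk C) ≈ walkProduct (λ r → g (⟶⇒∼ r)) (Cycle.walk C))
    where

    private
      module F = Normalised f f-inverse
      module G = Normalised g g-inverse

      -- Cutting the root path of `t` at `s` yields a single fundamental cycle whose two products
      -- equal the two normalised weights; the hypothesis compares them.
      closing-arc-agrees : ∀ {s t} (e : s ∼ t) → ¬ (s ∼ᵀ t) → s ≤ᵀ t →
                           F.normalised (symm e) ≈ G.normalised (symm e)
      closing-arc-agrees {s} {t} e e∉T (P , s∈P) with split-at (Path.walk P) s∈P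
      ... | a , w , eq = begin
        F.normalised (symm e)                     ≈⟨ F.normalised-fundamental a w uniq e e∉T ⟩
        walkProduct (λ r → f (⟶⇒∼ r)) (Cycle.walk C)
          ≈⟨ same-cycle-product s t C (FundamentalCycle.isFundamental 𝒯 a w uniq e e∉T) ⟩
        walkProduct (λ r → g (⟶⇒∼ r)) (Cycle.walk C)
          ≈⟨ G.normalised-fundamental a w uniq e e∉T ⟨
        G.normalised (symm e) ∎
        where
        uniq : Unique (vertices (a ◅◅ w))
        uniq = ≡.subst (λ b → Unique (vertices b)) (≡.sym eq) (Path.distinct P)
        C = FundamentalCycle.cycle 𝒯 a w uniq e e∉T

    normalised-agree : ∀ {s t} (e : s ∼ t) → F.normalised e ≈ G.normalised e
    normalised-agree {s} {t} e with T? (Graph.adj tree s t)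
    ... | yes e∈T = trans (F.normalised-tree e e∈T) (sym (G.normalised-tree e e∈T))
    ... | no e∉T with normal s t e
    -- Here the closing arc is the reverse of `e`, so agreement on it passes to `e` by uniqueness of
    -- inverses.
    ...   | inj₁ s≤t = inverse-unique {x = F.normalised (symm e)}
              (trans (comm _ _) (F.normalised-symm e))
              (trans (∙-congˡ (closing-arc-agrees e e∉T s≤t)) (trans (comm _ _) (G.normalised-symm e)))
    -- Here `e` itself runs in the direction of the closing arc; it is the double reverse of itself.
    ...   | inj₂ t≤s = ≡.subst (λ e′ → F.normalised e′ ≈ G.normalised e′)
              (T-irrelevant (symm (symm e)) e)
              (closing-arc-agrees (symm e) (λ e∈T → e∉T (Graph.symm tree e∈T)) t≤s)

-- Determinants and characteristic polynomials under diagonal rescaling.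

module Determinants (R : CommutativeRing 0ℓ 0ℓ) where

  open CommutativeRing R hiding (zero)
  open Matrices R
  open RingProperties ring using (-‿distribˡ-*; -‿distribʳ-*)
  open SemiringExp semiring using (_^_)
  open SemiringSum semiring using (sum; sum-cong-≋; *-distribˡ-sum)
  open CommutativeMonoidSum *-commutativeMonoid
    using () renaming (sum to product; sum-remove to product-remove; sum-cong-≋ to product-cong;
                       ∑-distrib-+ to product-distrib-*; sum-replicate-zero to product-ones)
  open CommutativeMonoidSolver *-commutativeMonoid using (solve; _⊕_; _⊜_)
  open SetoidReasoning setoid

  det-cong : ∀ {n} {A B : Matrix n} → (∀ s t → A s t ≈ B s t) → det A ≈ det B
  det-cong {zero}  A≈B = refl
  det-cong {suc n} A≈B = sum-cong-≋ λ j →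
    *-cong (*-congˡ {x = (- 1#) ^ toℕ j} (A≈B zero j)) (det-cong λ s t → A≈B (suc s) (punchIn j t))

  -- Induction along the Laplace expansion. The minor loses row `zero` but column `j`, so the row
  -- factors and column factors must be independent vectors.
  det-rescale : ∀ {n} (A : Matrix n) (p q : Vector Carrier n) →
                det (λ s t → p s * A s t * q t) ≈ (product p * product q) * det A
  det-rescale {zero}  A p q = sym (trans (*-identityʳ _) (*-identityʳ _))
  det-rescale {suc n} A p q = begin
    sum (λ j → sign j * (p zero * A zero j * q j) * det (λ s t → p (suc s) * minor j s t * q (punchIn j t)))
      ≈⟨ sum-cong-≋ (λ j → *-congˡ {x = sign j * (p zero * A zero j * q j)}
           (det-rescale (minor j) (λ s → p (suc s)) (λ t → q (punchIn j t)))) ⟩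
    sum (λ j → sign j * (p zero * A zero j * q j) * ((p′ * product (λ t → q (punchIn j t))) * det (minor j)))
      ≈⟨ sum-cong-≋ rearrange ⟩
    sum (λ j → (product p * product q) * (sign j * A zero j * det (minor j)))
      ≈⟨ *-distribˡ-sum (product p * product q) (λ j → sign j * A zero j * det (minor j)) ⟨
    (product p * product q) * det A ∎
    where
    sign : Fin (suc n) → Carrier
    sign j = (- 1#) ^ toℕ j
    minor : Fin (suc n) → Matrix n
    minor j s t = A (suc s) (punchIn j t)
    p′ : Carrier
    p′ = product (λ s → p (suc s))
    rearrange : ∀ j →
      sign j * (p zero * A zero j * q j) * ((p′ * product (λ t → q (punchIn j t))) * det (minor j))
      ≈ (product p * product q) * (sign j * A zero j * det (minor j))
    rearrange j = trans
      (solve 7 (λ σ a m p₀ ps qⱼ qs →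
         (σ ⊕ ((p₀ ⊕ a) ⊕ qⱼ)) ⊕ ((ps ⊕ qs) ⊕ m) ⊜ ((p₀ ⊕ ps) ⊕ (qⱼ ⊕ qs)) ⊕ ((σ ⊕ a) ⊕ m))
         refl (sign j) (A zero j) (det (minor j)) (p zero) p′ (q j) (product (λ t → q (punchIn j t))))
      -- The factor `q j` of the entry and those of the minor, indexed through `punchIn j`,
      -- reassemble to the full product for every `j`.
      (*-congʳ (*-congˡ (sym (product-remove q))))

  module _ {n} (A : Matrix n) (p q : Vector Carrier n) (p*q : ∀ v → p v * q v ≈ 1#) where

    rescale-identity : ∀ s t → p s * identity s t * q t ≈ identity s t
    rescale-identity s t with s Fin.≟ t
    ... | yes ≡.refl = trans (*-congʳ (*-identityʳ _)) (p*q s)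
    ... | no  _      = trans (*-congʳ (zeroʳ _)) (zeroˡ _)

    -- With `p` and `q` mutually inverse the rescaling is conjugation by a diagonal matrix, which
    -- fixes scalar matrices.
    rescale-charMatrix : ∀ z s t →
      p s * (z * identity s t - A s t) * q t ≈ z * identity s t - p s * A s t * q t
    rescale-charMatrix z s t = begin
      p s * (z * I - A s t) * q t               ≈⟨ *-congʳ (distribˡ _ _ _) ⟩
      (p s * (z * I) + p s * - A s t) * q t     ≈⟨ distribʳ _ _ _ ⟩
      p s * (z * I) * q t + p s * - A s t * q t
        ≈⟨ +-cong
             (solve 4 (λ z i a b → (a ⊕ (z ⊕ i)) ⊕ b ⊜ z ⊕ ((a ⊕ i) ⊕ b)) refl z I (p s) (q t))
             (trans (*-congʳ (sym (-‿distribʳ-* _ _))) (sym (-‿distribˡ-* _ _))) ⟩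
      z * (p s * I * q t) - p s * A s t * q t   ≈⟨ +-congʳ (*-congˡ (rescale-identity s t)) ⟩
      z * I - p s * A s t * q t                 ∎
      where
      I = identity s t

    charPoly-rescale : ∀ z → charPoly (λ s t → p s * A s t * q t) z ≈ charPoly A z
    charPoly-rescale z = begin
      det (λ s t → z * identity s t - p s * A s t * q t)
        ≈⟨ det-cong (rescale-charMatrix z) ⟨
      det (λ s t → p s * (z * identity s t - A s t) * q t)
        ≈⟨ det-rescale _ p q ⟩
      (product p * product q) * charPoly A z
        -- The two products combine into the product of the `p v * q v`, all of them 1.
        ≈⟨ *-congʳ (trans (sym (product-distrib-* p q)) (trans (product-cong p*q) (product-ones n))) ⟩
      1# * charPoly A z
        ≈⟨ *-identityˡ _ ⟩
      charPoly A z ∎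

  charPoly-cong : ∀ {n} {A B : Matrix n} → (∀ s t → A s t ≈ B s t) → ∀ z → charPoly A z ≈ charPoly B z
  charPoly-cong A≈B z = det-cong λ s t → +-congˡ (-‿cong (A≈B s t))

  sameSpectrum-rescale : ∀ {n} (A B : Matrix n) (p q p′ q′ : Vector Carrier n) →
    (∀ v → p v * q v ≈ 1#) → (∀ v → p′ v * q′ v ≈ 1#) →
    (∀ s t → p s * A s t * q t ≈ p′ s * B s t * q′ t) → SameSpectrum A B
  sameSpectrum-rescale A B p q p′ q′ p*q p′*q′ agree λs =
    mk⇔ (λ A-spec z → trans (sym (same z)) (A-spec z)) (λ B-spec z → trans (same z) (B-spec z))
    where
    same : ∀ z → charPoly A z ≈ charPoly B z
    same z = begin
      charPoly A z                              ≈⟨ charPoly-rescale A p q p*q z ⟨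
      charPoly (λ s t → p s * A s t * q t) z    ≈⟨ charPoly-cong agree z ⟩
      charPoly (λ s t → p′ s * B s t * q′ t) z  ≈⟨ charPoly-rescale B p′ q′ p′*q′ z ⟩
      charPoly B z                              ∎

-- Adjacency matrices with weighted edges.

module WeightedAdjacency (R : CommutativeRing 0ℓ 0ℓ) {n} (G : Graph n) where

  open CommutativeRing R
  open Graph G using (adj; _∼_)
  open Matrices R using (Matrix)

  -- A specification by entries allows rewriting without unfolding the case distinction that defines
  -- the matrix.
  IsWeightedAdjacency : (∀ {s t} → s ∼ t → Carrier) → Matrix n → Set
  IsWeightedAdjacency f A =
    (∀ s t (e : s ∼ t) → A s t ≡ f e) × (∀ s t → ¬ (s ∼ t) → A s t ≡ 0#)

  rescaled-agree : ∀ {f g : ∀ {s t} → s ∼ t → Carrier} {A B : Matrix n} →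
    IsWeightedAdjacency f A → IsWeightedAdjacency g B → (p q p′ q′ : Fin n → Carrier) →
    (∀ {s t} (e : s ∼ t) → p s * f e * q t ≈ p′ s * g e * q′ t) →
    ∀ s t → p s * A s t * q t ≈ p′ s * B s t * q′ t
  rescaled-agree (A-edge , A-zero) (B-edge , B-zero) p q p′ q′ agree s t with T? (adj s t)
  ... | yes e rewrite A-edge s t e | B-edge s t e = agree e
  ... | no ¬e rewrite A-zero s t ¬e | B-zero s t ¬e =
    trans (annihilate (p s) (q t)) (sym (annihilate (p′ s) (q′ t)))
    where
    annihilate : ∀ a b → a * 0# * b ≈ 0#
    annihilate a b = trans (*-congʳ (zeroʳ a)) (zeroˡ b)

-- Gains as complex edge weights, and cospectrality.

module _ {n} {G : Graph n} (φ : Gain G) where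

  open Graph G using (adj; _∼_)
  open Gain φ
  open CommutativeRing ℂ-commutativeRing using (Carrier; *-commutativeMonoid)
  open WalkProduct *-commutativeMonoid using (walkProduct)
  open WeightedAdjacency ℂ-commutativeRing G using (IsWeightedAdjacency)

  gainℂ : ∀ {s t} → s ∼ t → Carrier
  gainℂ e = proj₁ (gain e)

  walkGain-walkProduct : {R : Rel (Fin n) 0ℓ} (f : R ⇒ _∼_) → ∀ {u v} (w : Star R u v) →
                         walkGain (Star.map f w) ≡ walkProduct (λ e → gainℂ (f e)) w
  walkGain-walkProduct f Star.ε  = ≡.refl
  walkGain-walkProduct f (e ◅ w) = ≡.cong (gainℂ (f e) Complex.*_) (walkGain-walkProduct f w)

  adjacencyMatrix-weighted : IsWeightedAdjacency gainℂ adjacencyMatrix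
  adjacencyMatrix-weighted = on-edge , off-edge
    where
    on-edge : ∀ s t (e : s ∼ t) → adjacencyMatrix s t ≡ gainℂ e
    on-edge s t e with T? (adj s t)
    ... | yes e′ = ≡.cong gainℂ (T-irrelevant e′ e)
    ... | no ¬e  = contradiction e ¬e
    off-edge : ∀ s t → ¬ (s ∼ t) → adjacencyMatrix s t ≡ Complex.0#
    off-edge s t ¬e with T? (adj s t)
    ... | yes e = contradiction e ¬e
    ... | no _  = ≡.refl

theorem3p2 : ∀ {n : ℕ} (G : Graph n) → Graph.Connected G →
    (φ₁ φ₂ : Gain G) →
    (𝒯 : RootedSpanningTree G) → RootedSpanningTree.Normal 𝒯 →
    (∀ (s t : Fin n) (C : Cycle (RootedSpanningTree._⟶_ 𝒯)) →
    RootedSpanningTree.IsFundamentalCycle 𝒯 s t C →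
    CommutativeRing._≈_ ℂ-commutativeRing
    (Gain.cycleGain φ₁ (RootedSpanningTree.⟶⇒∼ 𝒯) C)
    (Gain.cycleGain φ₂ (RootedSpanningTree.⟶⇒∼ 𝒯) C)) →
    𝕋-Cospectral φ₁ φ₂
theorem3p2 G _ φ₁ φ₂ 𝒯 normal same-cycle-gain =
  sameSpectrum-rescale (Gain.adjacencyMatrix φ₁) (Gain.adjacencyMatrix φ₂) N₁.p N₁.q N₂.p N₂.q N₁.p∙q N₂.p∙q
    (rescaled-agree {f = gainℂ φ₁} {g = gainℂ φ₂}
      (adjacencyMatrix-weighted φ₁) (adjacencyMatrix-weighted φ₂) N₁.p N₁.q N₂.p N₂.q
      (normalised-agree normal (gainℂ φ₁) (gainℂ φ₂) (Gain.gain-inverse φ₁) (Gain.gain-inverse φ₂)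
        -- The hypothesis on cycle gains is transported to products of edge weights along the same
        -- cycle.
        λ s t C fundamental → ≡.subst₂ Complex._≈_
          (walkGain-walkProduct φ₁ ⟶⇒∼ (Cycle.walk C))
          (walkGain-walkProduct φ₂ ⟶⇒∼ (Cycle.walk C))
          (same-cycle-gain s t C fundamental)))
  where
  open RootedSpanningTree 𝒯 using (⟶⇒∼)
  open Determinants ℂ-commutativeRing using (sameSpectrum-rescale)
  open WeightedAdjacency ℂ-commutativeRing G using (rescaled-agree)
  open Switching (CommutativeRing.*-commutativeMonoid ℂ-commutativeRing) 𝒯
  module N₁ = Normalised (gainℂ φ₁) (Gain.gain-inverse φ₁)
  module N₂ = Normalised (gainℂ φ₂) (Gain.gain-inverse φ₂)
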